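{- Let $\mathcal{H}$ be a family of graphs. There is a constant $C=C(\mathcal{H})$ such that $$\#\{v\in V(G):c(N(v))\ge 2\}\le C$$ for every $\mathcal{H}$-free graph $G$ if and only if $$\mathcal{H}\le\{K_n^*,\ nP_3,\ K_{1,n}^*,\ K_{2,n},\ CK_n,\ T_n\}$$ for some positive integer $n$.
   Context: All graphs are finite, undirected and simple (not necessarily connected). For graphs $H_1,H_2$, write $H_1\le H_2$ if $H_1$ is (isomorphic to) an induced subgraph of $H_2$. A graph $G$ is $\mathcal{H}$-free if there is no $H\in\mathcal{H}$ with $H\le G$. For families of graphs $\mathcal{H}_1,\mathcal{H}_2$, write $\mathcal{H}_1\le\mathcal{H}_2$ if for every $H_2\in\mathcal{H}_2$ there is $H_1\in\mathcal{H}_1$ with $H_1\le H_2$. $N(v)$ is the set of vertices of $G$ adjacent to $v$, and for $S\subset V(G)$, $c(S)$ is the number of connected components of the induced subgraph $G[S]$. $K_n$ is the complete graph and $E_n$ the edgeless graph on $n$ vertices, $P_n$ the path on $n$ vertices, $K_{s,t}$ the complete bipartite graph. $G_1+G_2$ denotes the join of $G_1$ and $G_2$: the graph with vertex set $V(G_1)\sqcup V(G_2)$ whose edges are those of $G_1$, those of $G_2$, and all pairs $\{x,y\}$ with $x\in V(G_1)$, $y\in V(G_2)$. $nG$ denotes the disjoint union of $n$ copies of $G$. $K_{1,n}^*$ is obtained from the star $K_{1,n}$ by attaching one pendant vertex to each of its $n$ leaves. $K_n^*$ is obtained from $K_n$ by attaching one pendant vertex to every vertex of $K_n$. $CK_n$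 is obtained from two disjoint copies of $K_n$ by adding a perfect matching between them. $T_n$ is obtained from the join $K_n+E_n$ by adding one new vertex adjacent to exactly the vertices of $E_n$. -}

module Defs where

open import Data.Bool using (Bool; true; false; not; _∧_; _∨_; T)
open import Data.Bool.Properties using (T?; ∨-comm; ∧-zeroʳ)
open import Data.Fin using (Fin; toℕ)
open import Data.Fin.Properties using (+↔⊎; *↔×) renaming (_≟_ to _≟F_)
open import Data.Fin.Subset using (Subset; _∈_)
open import Data.Fin.Subset.Properties using (_∈?_)
open import Data.List using (List; []; _∷_; length; filter; deduplicate; allFin)
open import Data.List.Membership.Propositional using () renaming (_∈_ to _∈ᴸ_)
open import Data.List.Membership.Propositional.Properties using (∈-allFin)
open import Data.List.Relation.Unary.Any using (here; there)
open import Data.Nat using (ℕ; _+_; _≤?_; suc) renaming (_≟_ to _≟ℕ_)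
open import Data.Nat.Properties using (1+n≢n)
open import Data.Product using (Σ; ∃; _×_; _,_)
open import Data.Sum using (_⊎_; inj₁; inj₂)
open import Data.Sum.Function.Propositional using (_⊎-↔_)
open import Data.Sum.Properties using (≡-dec)
open import Data.Vec using (tabulate)
open import Function using (id; _∘_; _↔_; Inverse)
open import Function.Definitions using (Injective)
open import Function.Properties.Inverse using (↔-refl; ↔-sym; ↔-trans)
open import Level using (Level; _⊔_)
open import Relation.Binary using (Rel; Decidable; DecidableEquality)
open import Relation.Binary.Construct.Closure.ReflexiveTransitive using (Star; ε; _◅_; _◅◅_)
open import Relation.Binary.PropositionalEquality using (_≡_; refl; sym; trans; cong; cong₂)
open import Relation.Nullary using (¬_; yes; no; does)
open import Relation.Nullary.Decidable using (map′; _×-dec_; _⊎-dec_; dec-true; dec-false)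
open import Relation.Unary using (Pred)

private
  variable
    a ℓ₁ ℓ₂ : Level
    V W : Set

record GraphOn (V : Set) : Set where
  field
    adj        : V → V → Bool
    adj-sym    : ∀ x y → adj x y ≡ adj y x
    adj-irrefl : ∀ x → adj x x ≡ false

open GraphOn public

-- Up to isomorphism every finite simple graph has vertex set Fin n.
record Graph : Set where
  constructor mkGraph
  field
    order : ℕ
    on    : GraphOn (Fin order)

  Vertex : Set
  Vertex = Fin order

open Graph public using (order; on; Vertex)

relabel : ∀ {n} → V ↔ Fin n → GraphOn V → Graph
relabel {n = n} e G = mkGraph n record
  { adj        = λ i j → adj G (from i) (from j)
  ; adj-sym    = λ i j → adj-sym G (from i) (from j)
  ; adj-irrefl = λ i → adj-irrefl G (from i)
  }
  where open Inverse e using (from)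

infix 4 _≤ᵍ_ _≼_

-- H ≤ᵍ G: H is isomorphic to an induced subgraph of G.
_≤ᵍ_ : Graph → Graph → Set
H ≤ᵍ G = Σ (Vertex H → Vertex G) λ f →
  Injective _≡_ _≡_ f × (∀ x y → adj (on H) x y ≡ adj (on G) (f x) (f y))

-- For an arbitrary (not necessarily decidable) 𝓗, extracting some H ∈ 𝓗 with
-- H ≤ᵍ G from ¬ Free 𝓗 G requires excluded middle.
Free : Pred Graph a → Graph → Set a
Free 𝓗 G = ¬ (∃ λ H → 𝓗 H × H ≤ᵍ G)

_≼_ : Pred Graph ℓ₁ → Pred Graph ℓ₂ → Set (ℓ₁ ⊔ ℓ₂)
𝓗₁ ≼ 𝓗₂ = ∀ H₂ → 𝓗₂ H₂ → ∃ λ H₁ → 𝓗₁ H₁ × H₁ ≤ᵍ H₂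

-- Reachability in a finite decidable relation is decidable (Warshall's
-- algorithm: Via ks x y is a path whose interior vertices lie in ks).
module _ {n : ℕ} {R : Rel (Fin n) a} (R? : Decidable R) where

  private
    Via : List (Fin n) → Rel (Fin n) a
    Via []       x y = x ≡ y ⊎ R x y
    Via (k ∷ ks) x y = Via ks x y ⊎ (Via ks x k × Via ks k y)

    via? : ∀ ks → Decidable (Via ks)
    via? []       x y = (x ≟F y) ⊎-dec R? x y
    via? (k ∷ ks) x y = via? ks x y ⊎-dec (via? ks x k ×-dec via? ks k y)

    base : ∀ ks {x y} → x ≡ y ⊎ R x y → Via ks x y
    base []       p = p
    base (k ∷ ks) p = inj₁ (base ks p)

    compose : ∀ {k ks x y} → k ∈ᴸ ks → Via ks x k → Via ks k y → Via ks x y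
    compose (here refl) p q = inj₂ (into p , outOf q)
      where
      into : ∀ {k ks x} → Via (k ∷ ks) x k → Via ks x k
      into (inj₁ p)       = p
      into (inj₂ (p , _)) = p
      outOf : ∀ {k ks y} → Via (k ∷ ks) k y → Via ks k y
      outOf (inj₁ q)       = q
      outOf (inj₂ (_ , q)) = q
    compose (there m) (inj₁ p)        (inj₁ q)        = inj₁ (compose m p q)
    compose (there m) (inj₁ p)        (inj₂ (q , q′)) = inj₂ (compose m p q , q′)
    compose (there m) (inj₂ (p , p′)) (inj₁ q)        = inj₂ (p , compose m p′ q)
    compose (there m) (inj₂ (p , _))  (inj₂ (_ , q′)) = inj₂ (p , q′)

    sound : ∀ ks {x y} → Via ks x y → Star R x y
    sound []       (inj₁ refl)    = ε
    sound []       (inj₂ r)       = r ◅ ε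
    sound (k ∷ ks) (inj₁ p)       = sound ks p
    sound (k ∷ ks) (inj₂ (p , q)) = sound ks p ◅◅ sound ks q

    complete : ∀ {x y} → Star R x y → Via (allFin n) x y
    complete ε = base (allFin n) (inj₁ refl)
    complete (_◅_ {j = j} r rs) =
      compose (∈-allFin j) (base (allFin n) (inj₂ r)) (complete rs)

  star? : Decidable (Star R)
  star? x y = map′ (sound (allFin n)) complete (via? (allFin n) x y)

module _ (G : Graph) where

  N : Vertex G → Subset (order G)
  N v = tabulate (adj (on G) v)

  -- Adjacency in the induced subgraph G[S].
  InducedAdj : Subset (order G) → Rel (Vertex G) _
  InducedAdj S x y = x ∈ S × y ∈ S × T (adj (on G) x y)

  inducedAdj? : ∀ S → Decidable (InducedAdj S)
  inducedAdj? S x y = (x ∈? S) ×-dec ((y ∈? S) ×-dec T? (adj (on G) x y))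

  Connected : Subset (order G) → Rel (Vertex G) _
  Connected S = Star (InducedAdj S)

  connected? : ∀ S → Decidable (Connected S)
  connected? S = star? (inducedAdj? S)

  -- The number of components of G[S]: deduplicating S up to Connected S
  -- keeps one representative of each component.
  c : Subset (order G) → ℕ
  c S = length (deduplicate (connected? S) (filter (_∈? S) (allFin (order G))))

  #disconnectedNeighbourhoods : ℕ
  #disconnectedNeighbourhoods =
    length (filter (λ v → 2 ≤? c (N v)) (allFin (order G)))

≟F-sym : ∀ {n} (i j : Fin n) → does (i ≟F j) ≡ does (j ≟F i)
≟F-sym i j with i ≟F j
... | yes i≡j = sym (dec-true (j ≟F i) (sym i≡j))
... | no  i≢j = sym (dec-false (j ≟F i) (i≢j ∘ sym))

K : ∀ n → GraphOn (Fin n)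
K n = record
  { adj        = λ i j → not (does (i ≟F j))
  ; adj-sym    = λ i j → cong not (≟F-sym i j)
  ; adj-irrefl = λ i → cong not (dec-true (i ≟F i) refl)
  }

E : ∀ n → GraphOn (Fin n)
E n = record
  { adj        = λ _ _ → false
  ; adj-sym    = λ _ _ → refl
  ; adj-irrefl = λ _ → refl
  }

P : ∀ n → GraphOn (Fin n)
P n = record
  { adj        = λ i j → next i j ∨ next j i
  ; adj-sym    = λ i j → ∨-comm (next i j) (next j i)
  ; adj-irrefl = λ i → cong₂ _∨_ (next-irrefl i) (next-irrefl i)
  }
  where
  next : Fin n → Fin n → Bool
  next i j = does (suc (toℕ i) ≟ℕ toℕ j)
  next-irrefl : ∀ i → next i i ≡ false
  next-irrefl i = dec-false (suc (toℕ i) ≟ℕ toℕ i) 1+n≢n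

-- The disjoint union of G and H together with the edges {x , y},
-- x ∈ V, y ∈ W, for which R x y holds.
glue : GraphOn V → GraphOn W → (V → W → Bool) → GraphOn (V ⊎ W)
glue {V} {W} G H R = record { adj = A ; adj-sym = A-sym ; adj-irrefl = A-irrefl }
  where
  A : V ⊎ W → V ⊎ W → Bool
  A (inj₁ x) (inj₁ y) = adj G x y
  A (inj₁ x) (inj₂ y) = R x y
  A (inj₂ x) (inj₁ y) = R y x
  A (inj₂ x) (inj₂ y) = adj H x y
  A-sym : ∀ x y → A x y ≡ A y x
  A-sym (inj₁ x) (inj₁ y) = adj-sym G x y
  A-sym (inj₁ x) (inj₂ y) = refl
  A-sym (inj₂ x) (inj₁ y) = refl
  A-sym (inj₂ x) (inj₂ y) = adj-sym H x y
  A-irrefl : ∀ x → A x x ≡ false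
  A-irrefl (inj₁ x) = adj-irrefl G x
  A-irrefl (inj₂ x) = adj-irrefl H x

join : GraphOn V → GraphOn W → GraphOn (V ⊎ W)
join G H = glue G H (λ _ _ → true)

copies : ∀ n → GraphOn V → GraphOn (Fin n × V)
copies n G = record
  { adj        = λ (i , x) (j , y) → does (i ≟F j) ∧ adj G x y
  ; adj-sym    = λ (i , x) (j , y) → cong₂ _∧_ (≟F-sym i j) (adj-sym G x y)
  ; adj-irrefl = λ (i , x) → trans (cong (does (i ≟F i) ∧_) (adj-irrefl G x)) (∧-zeroʳ _)
  }

-- Attach n pendant vertices to G, the i-th one to the vertex f i.
attachPendants : ∀ {n} → DecidableEquality V → GraphOn V → (Fin n → V) → GraphOn (V ⊎ Fin n)
attachPendants {n = n} _≟_ G f = glue G (E n) (λ x i → does (x ≟ f i))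

completeBipartite : ∀ s t → GraphOn (Fin s ⊎ Fin t)
completeBipartite s t = join (E s) (E t)

⊎↔+ : ∀ {m n} → (Fin m ⊎ Fin n) ↔ Fin (m + n)
⊎↔+ = ↔-sym +↔⊎

⊎⊎↔+ : ∀ {m n k} → ((Fin m ⊎ Fin n) ⊎ Fin k) ↔ Fin ((m + n) + k)
⊎⊎↔+ = ↔-trans (⊎↔+ ⊎-↔ ↔-refl) ⊎↔+

K[_]* : ℕ → Graph
K[ n ]* = relabel ⊎↔+ (attachPendants _≟F_ (K n) id)

_P₃ : ℕ → Graph
n P₃ = relabel (↔-sym *↔×) (copies n (P 3))

K[1,_]* : ℕ → Graph
K[1, n ]* = relabel ⊎⊎↔+ (attachPendants (≡-dec _≟F_ _≟F_) (completeBipartite 1 n) inj₂)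

K[2,_] : ℕ → Graph
K[2, n ] = relabel ⊎↔+ (completeBipartite 2 n)

CK : ℕ → Graph
CK n = relabel ⊎↔+ (glue (K n) (K n) (λ i j → does (i ≟F j)))

𝕋 : ℕ → Graph
𝕋 n = relabel ⊎⊎↔+ (glue (join (K n) (E n)) (E 1) inE)
  where
  inE : Fin n ⊎ Fin n → Fin 1 → Bool
  inE (inj₁ _) _ = false
  inE (inj₂ _) _ = true

Obstructions : ℕ → Pred Graph _
Obstructions n G = G ∈ᴸ K[ n ]* ∷ n P₃ ∷ K[1, n ]* ∷ K[2, n ] ∷ CK n ∷ 𝕋 n ∷ []

-- Necessity: each obstruction with parameter n ≥ 2 has n vertices whose
-- neighbourhood is disconnected.
--
-- Sufficiency: a vertex v with disconnected neighbourhood is the middle of a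
-- "cherry" a - v - b with a and b in different components of G[N(v)].  If one
-- vertex w is adjacent to many such v, then one prong of each cherry may be taken
-- to be w, since w cannot be connected to both a and b in N(v).  Ramsey's theorem
-- makes the adjacencies among the v_i and b_i uniform: if b_i ~ v_j for all i < j, or
-- for all i > j, then w and a single b have many common neighbours, giving K_{2,n};
-- otherwise the v_i and b_i are perfectly matched and give CK_n, K_n^* or K_{1,n}^*.
-- If there is no such w, Ramsey's theorem yields cherries with independent v_i and no
-- edges from v_i to a_j or b_j for i ≠ j; an edge pattern among the a_i and b_j gives
-- K_n^* or K_{1,n}^*, and its absence gives nP_3.  T_n is not needed here: it contains
-- K_{2,n}.
module Submission where

open import Defs
open import Axiom.ExcludedMiddle using (ExcludedMiddle)
open import Data.Bool using (Bool; true; false; T; _∧_)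
open import Data.Bool.Properties using (T-≡) renaming (_≟_ to _≟ᵇ_)
open import Data.Empty using (⊥; ⊥-elim)
open import Data.Fin using (Fin; zero; suc; toℕ; inject≤; inject₁; fromℕ; _↑ˡ_) renaming (_<_ to _<ᶠ_)
open import Data.Fin.Properties using (<-cmp; toℕ-inject≤; injective⇒≤; *↔×; <⇒≢; inject≤-injective; suc-injective; inject₁-injective; ↑ˡ-injective; toℕ-inject₁; toℕ-fromℕ; inject₁ℕ<) renaming (_≟_ to _≟F_)
open import Data.Fin.Subset using (_∈_)
open import Data.Fin.Subset.Properties using (_∈?_)
open import Data.List using (List; []; _∷_; length; filter; allFin; lookup; deduplicate)
open import Data.List.Membership.Propositional using (lose) renaming (_∈_ to _∈ᴸ_)
open import Data.List.Membership.Propositional.Properties using (∈-lookup; ∈-filter⁺; ∈-filter⁻; ∈-deduplicate⁻; ∈-allFin)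
open import Data.List.Properties using (length-tabulate)
open import Data.List.Relation.Binary.Sublist.Propositional using (_⊆_; []; _∷_; _∷ʳ_; minimum; ⊆-trans)
open import Data.List.Relation.Binary.Sublist.Propositional.Properties using (All-resp-⊆; filter-⊆)
open import Data.List.Relation.Unary.All as All using (All; []; _∷_)
open import Data.List.Relation.Unary.All.Properties using (all-filter)
open import Data.List.Relation.Unary.AllPairs using (AllPairs; []; _∷_)
open import Data.List.Relation.Unary.AllPairs.Properties using (tabulate⁺-<)
open import Data.List.Relation.Unary.Any using (Any; here; there)
open import Data.List.Relation.Unary.Any.Properties using (deduplicate⁺; lookup-index)
open import Data.List.Relation.Unary.Unique.Propositional using (Unique)
open import Data.List.Relation.Unary.Unique.Propositional.Properties using (allFin⁺) renaming (filter⁺ to Unique-filter⁺)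
open import Data.Nat using (ℕ; zero; suc; _+_; _≤_; _<_; s≤s; z≤n; _≤?_; z<s; s<s)
open import Data.Nat.Properties using (≤-refl; ≤-trans; ≤-reflexive; ≰⇒>; +-mono-<; +-suc; <⇒≱; <⇒≤; ≮⇒≥; m≤n+m)
open import Data.Product using (∃; ∃-syntax; _×_; _,_; Σ; proj₁; proj₂)
open import Data.Sum using (_⊎_; inj₁; inj₂)
open import Data.Sum.Properties using (≡-dec; inj₁-injective; inj₂-injective)
open import Data.Vec.Properties using ([]=⇒lookup; lookup⇒[]=; lookup∘tabulate)
open import Function using (_∘_; id; _↔_; Inverse; Equivalence; _⇔_; mk⇔)
open import Function.Definitions using (Injective)
open import Function.Properties.Inverse using (↔-sym)
open import Level using (Level)
open import Relation.Binary using (Rel; tri<; tri≈; tri>; Decidable; Symmetric; Transitive; Reflexive)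
open import Relation.Binary.Construct.Closure.ReflexiveTransitive using (ε; _◅_; _◅◅_; reverse)
open import Relation.Binary.PropositionalEquality using (_≡_; _≢_; refl; sym; trans; cong; subst; subst₂; cong₂)
open import Relation.Nullary using (yes; no; contradiction; ¬_; ¬?)
open import Relation.Nullary.Decidable using (dec-true; does)
open import Relation.Unary using (Pred)

private variable
  ℓ : Level
  A V W : Set
  L M : ℕ

-- Ramsey's theorem for finitely many two-colourings

AllPairs-resp-⊆ : {R : Rel A ℓ} {xs ys : List A} → ys ⊆ xs → AllPairs R xs → AllPairs R ys
AllPairs-resp-⊆ []         []         = []
AllPairs-resp-⊆ (_ ∷ʳ s)   (_ ∷ ps)   = AllPairs-resp-⊆ s ps
AllPairs-resp-⊆ (refl ∷ s) (px ∷ ps)  = All-resp-⊆ s px ∷ AllPairs-resp-⊆ s ps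

AllPairs-lookup : {R : Rel A ℓ} {xs : List A} → AllPairs R xs →
  ∀ {i j} → i <ᶠ j → R (lookup xs i) (lookup xs j)
AllPairs-lookup (px ∷ ps) {zero}  {suc j} _         = All.lookup px (∈-lookup j)
AllPairs-lookup (px ∷ ps) {suc i} {suc j} (s≤s i<j) = AllPairs-lookup ps i<j

offDiagonal : {R : Rel (Fin L) ℓ} → (∀ {i j} → i <ᶠ j → R i j) → (∀ {i j} → i <ᶠ j → R j i) →
  ∀ {i j} → i ≢ j → R i j
offDiagonal lt gt {i} {j} i≢j with <-cmp i j
... | tri< i<j _ _ = lt i<j
... | tri≈ _ i≡j _ = contradiction i≡j i≢j
... | tri> _ _ j<i = gt j<i

length-filter-split : (γ : A → Bool) (xs : List A) →
  length xs ≡ length (filter (λ x → γ x ≟ᵇ true) xs) + length (filter (λ x → γ x ≟ᵇ false) xs)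
length-filter-split γ [] = refl
length-filter-split γ (x ∷ xs) with γ x
... | true  = cong suc (length-filter-split γ xs)
... | false = trans (cong suc (length-filter-split γ xs)) (sym (+-suc _ _))

+-≤-split : ∀ {a b c d} → a + b ≤ c + d → a ≤ c ⊎ b ≤ d
+-≤-split {a} {b} {c} {d} a+b≤c+d with a ≤? c | b ≤? d
... | yes a≤c | _       = inj₁ a≤c
... | no _    | yes b≤d = inj₂ b≤d
... | no a≰c  | no b≰d  = contradiction a+b≤c+d (<⇒≱ (+-mono-< (≰⇒> a≰c) (≰⇒> b≰d)))

-- The recurrence behind R(k,l) ≤ R(k-1,l) + R(k,l-1). The `suc` pays for the head of the list; the
-- value is `zero` when `k` or `l` is, since the empty sublist has either colour.
ramseyNumber : ℕ → ℕ → ℕ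
ramseyNumber zero    l       = zero
ramseyNumber (suc k) zero    = zero
ramseyNumber (suc k) (suc l) = suc (ramseyNumber k (suc l) + ramseyNumber (suc k) l)

module _ (β : A → A → Bool) where

  -- Sublists keep the order, and `AllPairs` compares only earlier entries with later ones, so `β`
  -- may be asymmetric.
  MonochromaticSublist : List A → ℕ → Bool → Set
  MonochromaticSublist xs k t =
    ∃[ ys ] ys ⊆ xs × length ys ≡ k × AllPairs (λ x y → β x y ≡ t) ys

  empty : ∀ {xs t} → MonochromaticSublist xs 0 t
  empty = [] , minimum _ , refl , []

  weaken : ∀ {xs zs k t} → xs ⊆ zs → MonochromaticSublist xs k t → MonochromaticSublist zs k t
  weaken s (ys , p , q , r) = ys , ⊆-trans p s , q , r

  extend : ∀ {x xs k t} → MonochromaticSublist (filter (λ y → β x y ≟ᵇ t) xs) k t →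
           MonochromaticSublist (x ∷ xs) (suc k) t
  extend {x} {xs} {t = t} (ys , s , eq , ps) =
    x ∷ ys , refl ∷ ⊆-trans s (filter-⊆ b? xs) , cong suc eq ,
    All-resp-⊆ s (all-filter b? xs) ∷ ps
    where b? = λ y → β x y ≟ᵇ t

  -- One colour class of the head is large enough for the induction. A sublist of that same colour
  -- is extended by the head; one of the other colour is kept.
  ramsey : ∀ k l xs → ramseyNumber k l ≤ length xs →
           MonochromaticSublist xs k true ⊎ MonochromaticSublist xs l false
  ramsey zero    l       xs       _       = inj₁ empty
  ramsey (suc k) zero    xs       _       = inj₂ empty
  ramsey (suc k) (suc l) (x ∷ xs) (s≤s h)
    with +-≤-split (≤-trans h (≤-reflexive (length-filter-split (β x) xs)))
  ... | inj₁ h₁ with ramsey k (suc l) _ h₁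
  ...   | inj₁ m = inj₁ (extend m)
  ...   | inj₂ m = inj₂ (weaken (x ∷ʳ filter-⊆ _ xs) m)
  ramsey (suc k) (suc l) (x ∷ xs) (s≤s h) | inj₂ h₂ with ramsey (suc k) l _ h₂
  ...   | inj₁ m = inj₁ (weaken (x ∷ʳ filter-⊆ _ xs) m)
  ...   | inj₂ m = inj₂ (extend m)

Increasing : (Fin M → Fin L) → Set
Increasing σ = ∀ {i j} → i <ᶠ j → σ i <ᶠ σ j

Homogeneous : (A → A → Bool) → (Fin M → A) → Set
Homogeneous β f = ∃[ t ] (∀ {i j} → i <ᶠ j → β (f i) (f j) ≡ t)

ramsey-family : ∀ m (β : A → A → Bool) (f : Fin L → A) → ramseyNumber m m ≤ L →
  ∃[ σ ] Increasing {m} {L} σ × Homogeneous β (f ∘ σ)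
ramsey-family {L = L} m β f m≤L
  with ramsey (λ i j → β (f i) (f j)) m m (allFin L) (≤-trans m≤L (≤-reflexive (sym (length-tabulate id))))
-- A sublist of `allFin L` is strictly increasing, so `lookup ys` can serve as `σ`.
... | inj₁ (ys , s , refl , ps) =
  lookup ys , AllPairs-lookup (AllPairs-resp-⊆ s (tabulate⁺-< id)) , true , AllPairs-lookup ps
... | inj₂ (ys , s , refl , ps) =
  lookup ys , AllPairs-lookup (AllPairs-resp-⊆ s (tabulate⁺-< id)) , false , AllPairs-lookup ps

-- Abstract because comparing two unfolded Ramsey numbers does not terminate in practice.
abstract

  multiRamseyNumber : ℕ → ℕ → ℕ
  multiRamseyNumber m zero    = m
  multiRamseyNumber m (suc k) = ramseyNumber (multiRamseyNumber m k) (multiRamseyNumber m k)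

  -- One colouring at a time: `β` is made homogeneous on a family still long enough for the
  -- remaining ones, and homogeneity passes to increasing subfamilies.
  multiRamsey : ∀ m (βs : List (A → A → Bool)) (f : Fin L → A) → multiRamseyNumber m (length βs) ≤ L →
    ∃[ σ ] Increasing {m} {L} σ × All (λ β → Homogeneous β (f ∘ σ)) βs
  multiRamsey m []       f h =
    (λ i → inject≤ i h) ,
    (λ {i} {j} → subst₂ _<_ (sym (toℕ-inject≤ i h)) (sym (toℕ-inject≤ j h))) ,
    []
  multiRamsey m (β ∷ βs) f h =
    let σ , σ↑ , t , σ-mono = ramsey-family (multiRamseyNumber m (length βs)) β f h
        τ , τ↑ , hs         = multiRamsey m βs (f ∘ σ) ≤-refl
    in  σ ∘ τ , (λ i<j → σ↑ (τ↑ i<j)) , (t , λ i<j → σ-mono (τ↑ i<j)) ∷ hs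

-- Vertices with disconnected neighbourhood

Unique⇒lookup-injective : {A : Set} {xs : List A} → Unique xs → Injective _≡_ _≡_ (lookup xs)
Unique⇒lookup-injective {xs = xs} xs! {i} {j} eq with i ≟F j
... | yes i≡j = i≡j
... | no  i≢j = contradiction eq (offDiagonal (AllPairs-lookup xs!) (λ i<j → AllPairs-lookup xs! i<j ∘ sym) i≢j)

injection⇒≤length : {A : Set} {n : ℕ} {f : Fin n → A} {xs : List A} →
  Injective _≡_ _≡_ f → (∀ i → f i ∈ᴸ xs) → n ≤ length xs
injection⇒≤length {f = f} {xs} inj f∈ = injective⇒≤ λ {i} {j} eq →
  inj (trans (lookup-index (f∈ i)) (trans (cong (lookup xs) eq) (sym (lookup-index (f∈ j)))))

module _ {A : Set} {R : Rel A ℓ} (R? : Decidable R) where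

  -- Every entry is related to one that is kept, so a single kept entry would relate `x` to `y`.
  unrelated⇒2≤deduplicate : Reflexive R → Symmetric R → Transitive R →
    ∀ {xs x y} → x ∈ᴸ xs → y ∈ᴸ xs → ¬ R x y → 2 ≤ length (deduplicate R? xs)
  unrelated⇒2≤deduplicate R-refl R-sym R-trans {xs} {x} {y} x∈ y∈ x≁y =
    go (deduplicate R? xs) (represented x∈) (represented y∈)
    where
    represented : ∀ {z} → z ∈ᴸ xs → Any (R z) (deduplicate R? xs)
    represented z∈ = deduplicate⁺ R? (λ b~a z~a → R-trans z~a (R-sym b~a)) (lose z∈ R-refl)
    go : ∀ ds → Any (R x) ds → Any (R y) ds → 2 ≤ length ds
    go (_ ∷ [])    (here x~d) (here y~d) = contradiction (R-trans x~d (R-sym y~d)) x≁y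
    go (_ ∷ _ ∷ _) _          _          = s≤s (s≤s z≤n)

  -- The head is always kept and everything related to it is removed, so a second survivor is
  -- unrelated to the head.
  2≤deduplicate⇒unrelated : ∀ xs → 2 ≤ length (deduplicate R? xs) →
    ∃[ x ] ∃[ y ] x ∈ᴸ xs × y ∈ᴸ xs × ¬ R x y
  2≤deduplicate⇒unrelated (x ∷ xs) (s≤s h)
    with filter (λ y → ¬? (R? x y)) (deduplicate R? xs) in eq
  ... | y ∷ _ =
    let y∈ , x≁y = ∈-filter⁻ (λ y → ¬? (R? x y)) (subst (y ∈ᴸ_) (sym eq) (here refl))
    in  x , y , here refl , there (∈-deduplicate⁻ R? xs y∈) , x≁y

module _ (G : Graph) where

  ∈N⁺ : ∀ {v u} → adj (on G) v u ≡ true → u ∈ N G v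
  ∈N⁺ {v} {u} vu = lookup⇒[]= u (N G v) (trans (lookup∘tabulate (adj (on G) v) u) vu)

  ∈N⁻ : ∀ {v u} → u ∈ N G v → adj (on G) v u ≡ true
  ∈N⁻ {v} {u} u∈N = trans (sym (lookup∘tabulate (adj (on G) v) u)) ([]=⇒lookup u∈N)

  Connected-sym : ∀ {S} → Symmetric (Connected G S)
  Connected-sym = reverse λ (x∈ , y∈ , xy) → y∈ , x∈ , subst T (adj-sym (on G) _ _) xy

  Separated : Vertex G → Vertex G → Vertex G → Set
  Separated v a b = adj (on G) v a ≡ true × adj (on G) v b ≡ true × ¬ Connected G (N G v) a b

  Separated⇒2≤c : ∀ {v a b} → Separated v a b → 2 ≤ c G (N G v)
  Separated⇒2≤c {v} (va , vb , a≁b) =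
    unrelated⇒2≤deduplicate (connected? G (N G v)) ε Connected-sym _◅◅_
      (∈-filter⁺ (_∈? N G v) (∈-allFin _) (∈N⁺ va)) (∈-filter⁺ (_∈? N G v) (∈-allFin _) (∈N⁺ vb)) a≁b

  2≤c⇒Separated : ∀ {v} → 2 ≤ c G (N G v) → ∃[ a ] ∃[ b ] Separated v a b
  2≤c⇒Separated {v} h =
    let a , b , a∈ , b∈ , a≁b = 2≤deduplicate⇒unrelated (connected? G (N G v)) _ h
    in  a , b ,
        ∈N⁻ (proj₂ (∈-filter⁻ (_∈? N G v) {xs = allFin (order G)} a∈)) ,
        ∈N⁻ (proj₂ (∈-filter⁻ (_∈? N G v) {xs = allFin (order G)} b∈)) , a≁b

  separated-family⇒≤# : ∀ {n} (f : Fin n → Vertex G) → Injective _≡_ _≡_ f →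
    (∀ i → ∃[ a ] ∃[ b ] Separated (f i) a b) → n ≤ #disconnectedNeighbourhoods G
  separated-family⇒≤# f inj sep = injection⇒≤length inj λ i →
    ∈-filter⁺ (λ v → 2 ≤? c G (N G v)) (∈-allFin _) (Separated⇒2≤c (proj₂ (proj₂ (sep i))))

  -- Turns the count into an injective family, the form to which Ramsey's theorem applies: the
  -- counted vertices are listed without repetition, and the first `n` of them are taken.
  ≤#⇒separated-family : ∀ {n} → n ≤ #disconnectedNeighbourhoods G →
    Σ (Fin n → Vertex G) λ f → Injective _≡_ _≡_ f × (∀ i → ∃[ a ] ∃[ b ] Separated (f i) a b)
  ≤#⇒separated-family n≤# =
    (λ i → lookup bad (inject≤ i n≤#)) ,
    (λ eq → inject≤-injective n≤# n≤# _ _ (Unique⇒lookup-injective (Unique-filter⁺ bad? (allFin⁺ (order G))) eq)) ,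
    (λ i → 2≤c⇒Separated (All.lookup (all-filter bad? (allFin (order G))) (∈-lookup (inject≤ i n≤#))))
    where
    bad? = λ v → 2 ≤? c G (N G v)
    bad  = filter bad? (allFin (order G))

-- A certificate of disconnectedness that avoids paths: a two-colouring constant along edges inside
-- the neighbourhood of `v` but not on all of it. The type `V` is arbitrary, so cuts are found
-- before relabelling by `Fin n`.
record Cut (H : GraphOn V) (v : V) : Set where
  field
    side      : V → Bool
    x y       : V
    vx        : adj H v x ≡ true
    vy        : adj H v y ≡ true
    x|y       : side x ≢ side y
    uncrossed : ∀ p q → adj H v p ≡ true → adj H v q ≡ true → adj H p q ≡ true → side p ≡ side q

module _ {n} (e : V ↔ Fin n) (H : GraphOn V) where
  open Inverse e

  -- By induction, `side` is constant along every path inside the neighbourhood.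
  Cut⇒Separated : ∀ {v} → Cut H v → ∃[ a ] ∃[ b ] Separated (relabel e H) (to v) a b
  Cut⇒Separated {v} C =
    to x , to y , trans (cong₂ (adj H) (strictlyInverseʳ v) (strictlyInverseʳ x)) vx ,
    trans (cong₂ (adj H) (strictlyInverseʳ v) (strictlyInverseʳ y)) vy ,
    λ x~y → x|y (subst₂ (λ p q → side p ≡ side q) (strictlyInverseʳ x) (strictlyInverseʳ y) (constant x~y))
    where
    open Cut C
    G = relabel e H
    neighbour : ∀ {u} → u ∈ N G (to v) → adj H v (from u) ≡ true
    neighbour u∈ = trans (cong (λ w → adj H w _) (sym (strictlyInverseʳ v))) (∈N⁻ G u∈)
    constant : ∀ {a b} → Connected G (N G (to v)) a b → side (from a) ≡ side (from b)
    constant ε = refl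
    constant ((p∈ , q∈ , pq) ◅ rest) =
      trans (uncrossed _ _ (neighbour p∈) (neighbour q∈) (Equivalence.to T-≡ pq)) (constant rest)

  cut-family⇒≤# : ∀ {k} (f : Fin k → V) → Injective _≡_ _≡_ f → (∀ i → Cut H (f i)) →
    k ≤ #disconnectedNeighbourhoods (relabel e H)
  cut-family⇒≤# f inj cut = separated-family⇒≤# (relabel e H) (to ∘ f)
    (λ eq → inj (trans (sym (strictlyInverseʳ _)) (trans (cong from eq) (strictlyInverseʳ _))))
    (Cut⇒Separated ∘ cut)

-- Cuts in the six obstructions

does-refl : ∀ {n} (i : Fin n) → does (i ≟F i) ≡ true
does-refl i = dec-true (i ≟F i) refl

does⇒≡ : ∀ {n} (i j : Fin n) → does (i ≟F j) ≡ true → i ≡ j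
does⇒≡ i j h with i ≟F j
... | yes i≡j = i≡j

-- A clique vertex needs a neighbour inside the clique, hence two indices: for n = 1 both K_n^* and
-- CK_n are a single edge, where every neighbourhood is connected.
another : ∀ {n} → Fin (suc (suc n)) → Fin (suc (suc n))
another zero    = suc zero
another (suc _) = zero

K-another : ∀ {n} (i : Fin (suc (suc n))) → adj (K _) i (another i) ≡ true
K-another zero    = refl
K-another (suc _) = refl

K-irrefl : ∀ {n} (i j : Fin n) → adj (K n) i j ≡ true → i ≢ j
K-irrefl {n} i _ ij refl with () ← trans (sym ij) (adj-irrefl (K n) i)

onLeft : V ⊎ W → Bool
onLeft (inj₁ _) = true
onLeft (inj₂ _) = false

-- Covers both K_n^* and CK_n.
matched-clique-cut : ∀ {n} (H : GraphOn (Fin (suc (suc n)))) i →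
  Cut (glue (K (suc (suc n))) H (λ i j → does (i ≟F j))) (inj₁ i)
matched-clique-cut H i = record
  { side = onLeft
  ; x    = inj₁ (another i)
  ; y    = inj₂ i
  ; vx   = K-another i
  ; vy   = does-refl i
  ; x|y  = λ ()
  ; uncrossed = λ where
      (inj₁ _) (inj₁ _) _  _  _  → refl
      (inj₂ _) (inj₂ _) _  _  _  → refl
      -- Crossing edges are matching edges, so `i` and `k` would both equal `l`, although `k` is a
      -- neighbour of `i`.
      (inj₁ k) (inj₂ l) ik il kl → contradiction (trans (does⇒≡ i l il) (sym (does⇒≡ k l kl))) (K-irrefl i k ik)
      (inj₂ l) (inj₁ k) il ik kl → contradiction (trans (does⇒≡ i l il) (sym (does⇒≡ k l kl))) (K-irrefl i k ik)
  }

nP₃-cut : ∀ {n} (i : Fin n) → Cut (copies n (P 3)) (i , suc zero)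
nP₃-cut i = record
  { side = λ (_ , p) → does (p ≟F zero)
  ; x = i , zero
  ; y = i , suc (suc zero)
  ; vx   = cong (_∧ true) (does-refl i)
  ; vy   = cong (_∧ true) (does-refl i)
  ; x|y  = λ ()
  ; uncrossed = λ where
      (_ , zero)        (_ , zero)           _ _ _  → refl
      (_ , suc _)       (_ , suc _)          _ _ _  → refl
      (_ , zero)        (_ , suc zero)       _ h _  → contradiction h (no-loop _)
      (_ , zero)        (_ , suc (suc zero)) _ _ h  → contradiction h (no-loop _)
      (_ , suc zero)    (_ , zero)           h _ _  → contradiction h (no-loop _)
      (_ , suc (suc zero)) (_ , zero)        _ _ h  → contradiction h (no-loop _)
  }
  where
  no-loop : ∀ b → b ∧ false ≢ true
  no-loop true  ()
  no-loop false ()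

K₁ₙ*-cut : ∀ {n} (i : Fin n) →
  Cut (attachPendants (≡-dec _≟F_ _≟F_) (completeBipartite 1 n) inj₂) (inj₁ (inj₂ i))
K₁ₙ*-cut i = record
  { side = onLeft
  ; x    = inj₁ (inj₁ zero)
  ; y    = inj₂ i
  ; vx   = refl
  ; vy   = does-refl i
  ; x|y  = λ ()
  ; uncrossed = λ where
      (inj₁ _) (inj₁ _) _  _  _  → refl
      (inj₂ _) (inj₂ _) _  _  _  → refl
      (inj₁ (inj₁ _)) (inj₂ _) _ _ ()
      (inj₁ (inj₂ _)) (inj₂ _) () _ _
      (inj₂ _) (inj₁ (inj₁ _)) _ _ ()
      (inj₂ _) (inj₁ (inj₂ _)) _ () _
  }

K₂ₙ-cut : ∀ {n} (i : Fin n) → Cut (completeBipartite 2 n) (inj₂ i)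
K₂ₙ-cut i = record
  { side = λ where
      (inj₁ p) → does (p ≟F zero)
      -- A default value: no vertex of this class is a neighbour of `inj₂ i`.
      (inj₂ _) → true
  ; x = inj₁ zero
  ; y = inj₁ (suc zero)
  ; vx   = refl
  ; vy   = refl
  ; x|y  = λ ()
  ; uncrossed = λ where
      (inj₁ _) (inj₁ _) _ _ ()
      (inj₁ _) (inj₂ _) _ () _
      (inj₂ _) _ () _ _
  }

-- The clique and the added vertex lie on different sides and are not adjacent. As `inE` is local to
-- `𝕋`, the attaching relation is a parameter `R` described by its values.
𝕋-cut : ∀ {n} {R : Fin (suc n) ⊎ Fin (suc n) → Fin 1 → Bool} →
  (∀ k w → R (inj₁ k) w ≡ false) → (∀ i w → R (inj₂ i) w ≡ true) → (i : Fin (suc n)) →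
  Cut (glue (join (K (suc n)) (E (suc n))) (E 1) R) (inj₁ (inj₂ i))
𝕋-cut R-K R-E i = record
  { side = onLeft
  ; x    = inj₁ (inj₁ zero)
  ; y    = inj₂ zero
  ; vx   = refl
  ; vy   = R-E i zero
  ; x|y  = λ ()
  ; uncrossed = λ where
      (inj₁ _) (inj₁ _) _ _ _ → refl
      (inj₂ _) (inj₂ _) _ _ _ → refl
      (inj₁ (inj₁ k)) (inj₂ w) _ _ kw → contradiction (trans (sym kw) (R-K k w)) λ ()
      (inj₁ (inj₂ _)) (inj₂ _) () _ _
      (inj₂ w) (inj₁ (inj₁ k)) _ _ kw → contradiction (trans (sym kw) (R-K k w)) λ ()
      (inj₂ _) (inj₁ (inj₂ _)) _ () _
  }

K*-cuts : ∀ m → suc (suc m) ≤ #disconnectedNeighbourhoods K[ suc (suc m) ]*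
K*-cuts m = cut-family⇒≤# ⊎↔+ (attachPendants _≟F_ (K (suc (suc m))) id) inj₁ inj₁-injective
  (matched-clique-cut (E (suc (suc m))))

nP₃-cuts : ∀ n → n ≤ #disconnectedNeighbourhoods (n P₃)
nP₃-cuts n = cut-family⇒≤# (↔-sym *↔×) (copies n (P 3)) (_, suc zero) (cong proj₁) nP₃-cut

K₁ₙ*-cuts : ∀ n → n ≤ #disconnectedNeighbourhoods K[1, n ]*
K₁ₙ*-cuts n = cut-family⇒≤# ⊎⊎↔+
  (attachPendants (≡-dec _≟F_ _≟F_) (completeBipartite 1 n) inj₂)
  (inj₁ ∘ inj₂) (inj₂-injective ∘ inj₁-injective) K₁ₙ*-cut

K₂ₙ-cuts : ∀ n → n ≤ #disconnectedNeighbourhoods K[2, n ]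
K₂ₙ-cuts n = cut-family⇒≤# ⊎↔+ (completeBipartite 2 n) inj₂ inj₂-injective K₂ₙ-cut

CK-cuts : ∀ m → suc (suc m) ≤ #disconnectedNeighbourhoods (CK (suc (suc m)))
CK-cuts m = cut-family⇒≤# ⊎↔+
  (glue (K (suc (suc m))) (K (suc (suc m))) (λ i j → does (i ≟F j)))
  inj₁ inj₁-injective (matched-clique-cut (K (suc (suc m))))

𝕋-cuts : ∀ m → suc m ≤ #disconnectedNeighbourhoods (𝕋 (suc m))
𝕋-cuts m = cut-family⇒≤# ⊎⊎↔+ (glue (join (K (suc m)) (E (suc m))) (E 1) _)
  (inj₁ ∘ inj₂) (inj₂-injective ∘ inj₁-injective) (𝕋-cut (λ _ _ → refl) (λ _ _ → refl))

obstruction⇒≤# : ∀ m {H} → Obstructions (suc (suc m)) H → suc (suc m) ≤ #disconnectedNeighbourhoods H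
obstruction⇒≤# m (here refl)                                         = K*-cuts m
obstruction⇒≤# m (there (here refl))                                 = nP₃-cuts (suc (suc m))
obstruction⇒≤# m (there (there (here refl)))                         = K₁ₙ*-cuts (suc (suc m))
obstruction⇒≤# m (there (there (there (here refl))))                 = K₂ₙ-cuts (suc (suc m))
obstruction⇒≤# m (there (there (there (there (here refl)))))         = CK-cuts m
obstruction⇒≤# m (there (there (there (there (there (here refl)))))) = 𝕋-cuts (suc m)

-- Recognising the obstructions inside a graph

infix 4 _↪_

-- The analogue of `_≤ᵍ_` for arbitrary vertex types, so that embeddings can be assembled on sums
-- and products.
_↪_ : GraphOn V → GraphOn W → Set
_↪_ {V} {W} H G = Σ (V → W) λ f → Injective _≡_ _≡_ f × (∀ x y → adj H x y ≡ adj G (f x) (f y))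

≤ᵍ-trans : ∀ {F G H} → F ≤ᵍ G → G ≤ᵍ H → F ≤ᵍ H
≤ᵍ-trans (f , f-inj , f-adj) (g , g-inj , g-adj) =
  g ∘ f , f-inj ∘ g-inj , λ x y → trans (f-adj x y) (g-adj (f x) (f y))

relabel-≤ : ∀ {n} (e : V ↔ Fin n) (H : GraphOn V) G → H ↪ on G → relabel e H ≤ᵍ G
relabel-≤ e H G (f , f-inj , f-adj) = f ∘ from , from-inj ∘ f-inj , λ x y → f-adj (from x) (from y)
  where
  open Inverse e
  from-inj : Injective _≡_ _≡_ from
  from-inj eq = trans (sym (strictlyInverseˡ _)) (trans (cong to eq) (strictlyInverseˡ _))

module _ (G : GraphOn W) where

  adj-≢ : ∀ {u x y} → adj G u x ≡ true → adj G u y ≡ false → x ≢ y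
  adj-≢ ux uy refl with () ← trans (sym ux) uy

  adj-true⇒≢ : ∀ {x y} → adj G x y ≡ true → x ≢ y
  adj-true⇒≢ {x} xy refl with () ← trans (sym xy) (adj-irrefl G x)

  adj-comm : ∀ {x y t} → adj G x y ≡ t → adj G y x ≡ t
  adj-comm xy = trans (adj-sym G _ _) xy

  Uniform : ∀ {n} → Bool → (Fin n → W) → Set
  Uniform t p = ∀ {i j} → i ≢ j → adj G (p i) (p j) ≡ t

  -- An induced matching as far as edges between `p` and `q` go; edges inside `p` or inside `q` are
  -- left open, so K_n^*, CK_n, K_{1,n}^* and nP_3 can all use it.
  record Matched {n} (p q : Fin n → W) : Set where
    constructor matched
    field
      edge    : ∀ i → adj G (p i) (q i) ≡ true
      nonedge : ∀ {i j} → i ≢ j → adj G (p i) (q j) ≡ false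

  open Matched

  Matched-sym : ∀ {n} {p q : Fin n → W} → Matched p q → Matched q p
  Matched-sym m = matched (adj-comm ∘ edge m) (λ i≢j → adj-comm (nonedge m (i≢j ∘ sym)))

  Matched-injective : ∀ {n} {p q : Fin n → W} → Matched p q → Injective _≡_ _≡_ q
  Matched-injective m {i} {j} eq with i ≟F j
  ... | yes i≡j = i≡j
  ... | no  i≢j = contradiction eq (adj-≢ (edge m i) (nonedge m i≢j))

  Matched-does : ∀ {n} {p q : Fin n → W} → Matched p q → ∀ i j → does (i ≟F j) ≡ adj G (p i) (q j)
  Matched-does m i j with i ≟F j
  ... | yes refl = sym (edge m i)
  ... | no  i≢j  = sym (nonedge m i≢j)

  -- For `i ≢ j`, the vertex `q i` is adjacent to `p i` but not to `q j`. This uses independence of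
  -- `q`; `CK-≤`, where `q` is a clique, assumes disjointness instead.
  Matched-≢ : ∀ {n} {p q : Fin n → W} → Matched p q → Uniform false q → ∀ i j → p i ≢ q j
  Matched-≢ m q-indep i j with i ≟F j
  ... | yes refl = adj-true⇒≢ (edge m i)
  ... | no  i≢j  = λ eq → adj-≢ (adj-comm (edge m i)) (q-indep i≢j) eq

  K-↪ : ∀ {n} {p : Fin n → W} → Uniform true p → K n ↪ G
  K-↪ {n} {p} clique = p , inj , preserves
    where
    inj : Injective _≡_ _≡_ p
    inj {i} {j} eq with i ≟F j
    ... | yes i≡j = i≡j
    ... | no  i≢j = contradiction eq (adj-true⇒≢ (clique i≢j))
    preserves : ∀ i j → adj (K n) i j ≡ adj G (p i) (p j)
    preserves i j with i ≟F j
    ... | yes refl = sym (adj-irrefl G (p i))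
    ... | no  i≢j  = sym (clique i≢j)

  E-↪ : ∀ {n} {p : Fin n → W} → Injective _≡_ _≡_ p → Uniform false p → E n ↪ G
  E-↪ {p = p} inj indep = p , inj , preserves
    where
    preserves : ∀ i j → false ≡ adj G (p i) (p j)
    preserves i j with i ≟F j
    ... | yes refl = sym (adj-irrefl G (p i))
    ... | no  i≢j  = sym (indep i≢j)

  glue-↪ : ∀ {V₁ V₂ : Set} {H₁ : GraphOn V₁} {H₂ : GraphOn V₂} {R : V₁ → V₂ → Bool}
    ((f , _) : H₁ ↪ G) ((g , _) : H₂ ↪ G) →
    (∀ x y → R x y ≡ adj G (f x) (g y)) → (∀ x y → f x ≢ g y) → glue H₁ H₂ R ↪ G
  glue-↪ {V₁} {V₂} {H₁} {H₂} {R} (f , f-inj , f-adj) (g , g-inj , g-adj) cross disjoint = h , h-inj , h-adj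
    where
    h : V₁ ⊎ V₂ → W
    h (inj₁ x) = f x
    h (inj₂ y) = g y
    h-inj : Injective _≡_ _≡_ h
    h-inj {inj₁ x} {inj₁ y} eq = cong inj₁ (f-inj eq)
    h-inj {inj₁ x} {inj₂ y} eq = contradiction eq (disjoint x y)
    h-inj {inj₂ x} {inj₁ y} eq = contradiction (sym eq) (disjoint y x)
    h-inj {inj₂ x} {inj₂ y} eq = cong inj₂ (g-inj eq)
    h-adj : ∀ x y → adj (glue H₁ H₂ R) x y ≡ adj G (h x) (h y)
    h-adj (inj₁ x) (inj₁ y) = f-adj x y
    h-adj (inj₁ x) (inj₂ y) = cross x y
    h-adj (inj₂ x) (inj₁ y) = trans (cross y x) (adj-sym G _ _)
    h-adj (inj₂ x) (inj₂ y) = g-adj x y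

module _ (G : Graph) where

  private
    Γ = on G
    _~_ : Vertex G → Vertex G → Bool
    _~_ = adj (on G)

  module _ {n} {p q : Fin n → Vertex G} (m : Matched Γ p q) where

    K*-≤ : Uniform Γ true p → Uniform Γ false q → K[ n ]* ≤ᵍ G
    K*-≤ p-clique q-indep = relabel-≤ ⊎↔+ (attachPendants _≟F_ (K n) id) G
      (glue-↪ Γ (K-↪ Γ p-clique) (E-↪ Γ (Matched-injective Γ m) q-indep)
        (Matched-does Γ m) (Matched-≢ Γ m q-indep))

    CK-≤ : Uniform Γ true p → Uniform Γ true q → (∀ i j → p i ≢ q j) → CK n ≤ᵍ G
    CK-≤ p-clique q-clique p≢q = relabel-≤ ⊎↔+ (glue (K n) (K n) (λ i j → does (i ≟F j))) G
      (glue-↪ Γ (K-↪ Γ p-clique) (K-↪ Γ q-clique) (Matched-does Γ m) p≢q)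

    K₁ₙ*-≤ : ∀ {w} → (∀ i → w ~ p i ≡ true) → (∀ i → w ~ q i ≡ false) → (∀ i → w ≢ q i) →
      Uniform Γ false p → Uniform Γ false q → K[1, n ]* ≤ᵍ G
    K₁ₙ*-≤ {w} w~p w≁q w≢q p-indep q-indep =
      relabel-≤ ⊎⊎↔+ (attachPendants (≡-dec _≟F_ _≟F_) (completeBipartite 1 n) inj₂) G
        (glue-↪ Γ star (E-↪ Γ (Matched-injective Γ m) q-indep) cross disjoint)
      where
      centre-↪ : E 1 ↪ Γ
      centre-↪ = E-↪ Γ {p = λ _ → w} (λ { {zero} {zero} _ → refl }) λ { {zero} {zero} 0≢0 → contradiction refl 0≢0 }
      star : completeBipartite 1 n ↪ Γ
      star = glue-↪ Γ centre-↪ (E-↪ Γ (Matched-injective Γ (Matched-sym Γ m)) p-indep)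
        (λ _ i → sym (w~p i)) (λ _ i → adj-true⇒≢ Γ (w~p i))
      cross : ∀ x j → does (≡-dec _≟F_ _≟F_ x (inj₂ j)) ≡ proj₁ star x ~ q j
      cross (inj₁ _) j = sym (w≁q j)
      cross (inj₂ i) j = trans (does-inj₂ i j) (Matched-does Γ m i j)
        where
        does-inj₂ : ∀ i j → does (≡-dec {A = Fin 1} _≟F_ _≟F_ (inj₂ i) (inj₂ j)) ≡ does (i ≟F j)
        does-inj₂ i j with i ≟F j
        ... | yes refl = refl
        ... | no _     = refl
      disjoint : ∀ x j → proj₁ star x ≢ q j
      disjoint (inj₁ _) j = w≢q j
      disjoint (inj₂ i) j = Matched-≢ Γ m q-indep i j

  K₂ₙ-≤ : ∀ {n w b} {p : Fin n → Vertex G} → w ≢ b → w ~ b ≡ false →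
    (∀ i → w ~ p i ≡ true) → (∀ i → b ~ p i ≡ true) →
    Injective _≡_ _≡_ p → Uniform Γ false p → K[2, n ] ≤ᵍ G
  K₂ₙ-≤ {n} {w} {b} {p} w≢b w≁b w~p b~p p-inj p-indep = relabel-≤ ⊎↔+ (completeBipartite 2 n) G
    (glue-↪ Γ (E-↪ Γ {p = pair} pair-inj pair-indep) (E-↪ Γ p-inj p-indep)
      (λ { zero i → sym (w~p i) ; (suc zero) i → sym (b~p i) })
      (λ { zero i → adj-true⇒≢ Γ (w~p i) ; (suc zero) i → adj-true⇒≢ Γ (b~p i) }))
    where
    pair : Fin 2 → Vertex G
    pair zero    = w
    pair (suc _) = b
    pair-inj : Injective _≡_ _≡_ pair
    pair-inj {zero}     {zero}     _  = refl
    pair-inj {zero}     {suc zero} eq = contradiction eq w≢b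
    pair-inj {suc zero} {zero}     eq = contradiction (sym eq) w≢b
    pair-inj {suc zero} {suc zero} _  = refl
    pair-indep : Uniform Γ false pair
    pair-indep {zero}     {zero}     0≢0 = contradiction refl 0≢0
    pair-indep {zero}     {suc zero} _   = w≁b
    pair-indep {suc zero} {zero}     _   = adj-comm Γ w≁b
    pair-indep {suc zero} {suc zero} 1≢1 = contradiction refl 1≢1

  nP₃-≤ : ∀ {n} {v a b : Fin n → Vertex G} → Matched Γ v a → Matched Γ v b →
    Uniform Γ false v → Uniform Γ false a → Uniform Γ false b →
    (∀ i j → a i ~ b j ≡ false) → (∀ i → a i ≢ b i) → n P₃ ≤ᵍ G
  nP₃-≤ {n} {v} {a} {b} va vb v-indep a-indep b-indep a≁b a≢b =
    relabel-≤ (↔-sym *↔×) (copies n (P 3)) G (f , f-inj , f-adj)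
    where
    f : Fin n × Fin 3 → Vertex G
    f (i , zero)           = a i
    f (i , suc zero)       = v i
    f (i , suc (suc zero)) = b i
    -- For `i ≢ j`, `v i` is adjacent to `a i` but not to `b j`. For equal indices it is adjacent to
    -- both, and the hypothesis `a≢b` decides.
    a≢b′ : ∀ i j → a i ≢ b j
    a≢b′ i j with i ≟F j
    ... | yes refl = a≢b i
    ... | no  i≢j  = adj-≢ Γ (Matched.edge va i) (Matched.nonedge vb i≢j)
    v≢a = Matched-≢ Γ va a-indep
    v≢b = Matched-≢ Γ vb b-indep
    f-inj : Injective _≡_ _≡_ f
    f-inj {i , zero}           {j , zero}           eq = cong (_, _) (Matched-injective Γ va eq)
    f-inj {i , zero}           {j , suc zero}       eq = contradiction (sym eq) (v≢a j i)
    f-inj {i , zero}           {j , suc (suc zero)} eq = contradiction eq (a≢b′ i j)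
    f-inj {i , suc zero}       {j , zero}           eq = contradiction eq (v≢a i j)
    f-inj {i , suc zero}       {j , suc zero}       eq = cong (_, _) (Matched-injective Γ (Matched-sym Γ va) eq)
    f-inj {i , suc zero}       {j , suc (suc zero)} eq = contradiction eq (v≢b i j)
    f-inj {i , suc (suc zero)} {j , zero}           eq = contradiction (sym eq) (a≢b′ j i)
    f-inj {i , suc (suc zero)} {j , suc zero}       eq = contradiction (sym eq) (v≢b j i)
    f-inj {i , suc (suc zero)} {j , suc (suc zero)} eq = cong (_, _) (Matched-injective Γ vb eq)
    within : ∀ i x y → adj (P 3) x y ≡ f (i , x) ~ f (i , y)
    within i zero           zero           = sym (adj-irrefl Γ (a i))
    within i zero           (suc zero)     = sym (adj-comm Γ (Matched.edge va i))
    within i zero           (suc (suc zero)) = sym (a≁b i i)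
    within i (suc zero)     zero           = sym (Matched.edge va i)
    within i (suc zero)     (suc zero)     = sym (adj-irrefl Γ (v i))
    within i (suc zero)     (suc (suc zero)) = sym (Matched.edge vb i)
    within i (suc (suc zero)) zero         = sym (adj-comm Γ (a≁b i i))
    within i (suc (suc zero)) (suc zero)   = sym (adj-comm Γ (Matched.edge vb i))
    within i (suc (suc zero)) (suc (suc zero)) = sym (adj-irrefl Γ (b i))
    between : ∀ {i j} x y → i ≢ j → false ≡ f (i , x) ~ f (j , y)
    between zero           zero           i≢j = sym (a-indep i≢j)
    between zero           (suc zero)     i≢j = sym (Matched.nonedge (Matched-sym Γ va) i≢j)
    between zero           (suc (suc zero)) _ = sym (a≁b _ _)
    between (suc zero)     zero           i≢j = sym (Matched.nonedge va i≢j)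
    between (suc zero)     (suc zero)     i≢j = sym (v-indep i≢j)
    between (suc zero)     (suc (suc zero)) i≢j = sym (Matched.nonedge vb i≢j)
    between (suc (suc zero)) zero         _   = sym (adj-comm Γ (a≁b _ _))
    between (suc (suc zero)) (suc zero)   i≢j = sym (Matched.nonedge (Matched-sym Γ vb) i≢j)
    between (suc (suc zero)) (suc (suc zero)) i≢j = sym (b-indep i≢j)
    f-adj : ∀ x y → adj (copies n (P 3)) x y ≡ f x ~ f y
    f-adj (i , x) (j , y) with i ≟F j
    ... | yes refl = within i x y
    ... | no  i≢j  = between x y i≢j

-- Unavoidable obstructions

Increasing⇒injective : ∀ {σ : Fin M → Fin L} → Increasing σ → Injective _≡_ _≡_ σ
Increasing⇒injective σ↑ {i} {j} eq with i ≟F j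
... | yes i≡j = i≡j
... | no  i≢j = contradiction eq (offDiagonal (<⇒≢ ∘ σ↑) (λ i<j → <⇒≢ (σ↑ i<j) ∘ sym) i≢j)

inject₁-increasing : ∀ {n} → Increasing (inject₁ {n})
inject₁-increasing {n} {i} {j} = subst₂ _<_ (sym (toℕ-inject₁ i)) (sym (toℕ-inject₁ j))

inject₁<fromℕ : ∀ {n} (i : Fin n) → inject₁ i <ᶠ fromℕ n
inject₁<fromℕ {n} i = subst (toℕ (inject₁ i) <_) (sym (toℕ-fromℕ n)) (inject₁ℕ< i)

-- Four colourings, and one fork more than `n` to act as the hub.
forkBound : ℕ → ℕ
forkBound n = multiRamseyNumber (suc n) 4

-- Nine colourings. The `suc` sets one cherry aside to provide the common vertex of a fan or the
-- centre of K_{1,n}^*; the sum leaves enough cherries both for `fan` and for a pattern of size `n`.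
cherryBound : ℕ → ℕ
cherryBound n = multiRamseyNumber (suc (n + forkBound n)) 9

module _ (G : Graph) where

  private
    Γ = on G
    _~_ : Vertex G → Vertex G → Bool
    _~_ = adj (on G)

  Contains : ℕ → Set
  Contains n = ∃ λ H → Obstructions n H × H ≤ᵍ G

  record Fork (w : Vertex G) : Set where
    field
      centre tip : Vertex G
      separated  : Separated G centre w tip

    stem : w ~ centre ≡ true
    stem = adj-comm Γ (proj₁ separated)

    prong : centre ~ tip ≡ true
    prong = proj₁ (proj₂ separated)

    -- Otherwise `w`, `u`, `tip` is a path inside the neighbourhood of `centre`.
    no-shortcut : ∀ {u} → centre ~ u ≡ true → w ~ u ≡ true → u ~ tip ≡ true → ⊥
    no-shortcut cu wu ut = proj₂ (proj₂ separated)
      ( (∈N⁺ G (adj-comm Γ stem) , ∈N⁺ G cu , Equivalence.from T-≡ wu)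
      ◅ (∈N⁺ G cu , ∈N⁺ G prong , Equivalence.from T-≡ ut) ◅ ε)

    w≁tip : w ~ tip ≡ false
    w≁tip with w ~ tip in eq
    ... | false = refl
    ... | true  = contradiction
      ((∈N⁺ G (adj-comm Γ stem) , ∈N⁺ G prong , Equivalence.from T-≡ eq) ◅ ε)
      (proj₂ (proj₂ separated))

    w≢tip : w ≢ tip
    w≢tip w≡tip = proj₂ (proj₂ separated) (subst (Connected G (N G centre) w) w≡tip ε)

  open Fork

  Cherry : Set
  Cherry = ∃ Fork

  left mid right : Cherry → Vertex G
  left      = proj₁
  mid   c   = centre (proj₂ c)
  right c   = tip (proj₂ c)

  -- The ends lie in different components, so `w` misses the component of one of them, and that end
  -- becomes the tip. The equation on centres lets injectivity carry over.
  rebase : ∀ {w} (c : Cherry) → w ~ mid c ≡ true → Σ (Fork w) λ k → centre k ≡ mid c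
  rebase {w} (a , k) w~v with connected? G (N G (centre k)) w a
  ... | no  w≁a = record { separated = adj-comm Γ w~v , adj-comm Γ (stem k) , w≁a } , refl
  ... | yes w-a = record { separated = adj-comm Γ w~v , prong k ,
    λ w-b → proj₂ (proj₂ (separated k)) (Connected-sym G w-a ◅◅ w-b) } , refl

  edge : {X : Set} → (X → Vertex G) → (X → Vertex G) → X → X → Bool
  edge p q x y = p x ~ q y

  module _ {m : ℕ} where

    private
      n = suc m

    -- The centres cannot form a clique: another centre would join w to the tip of z
    -- inside the neighbourhood of the centre of z.
    hub : ∀ {w t} (z : Fork w) (h : Fin n → Fork w) → Injective _≡_ _≡_ (centre ∘ h) →
      (∀ i → tip z ~ centre (h i) ≡ true) → (∀ i → centre z ~ centre (h i) ≡ t) →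
      Uniform Γ t (centre ∘ h) → Contains n
    hub {t = true}  z h inj tip~ centre~ uniform =
      ⊥-elim (no-shortcut z (centre~ zero) (stem (h zero)) (adj-comm Γ (tip~ zero)))
    hub {t = false} z h inj tip~ centre~ uniform =
      _ , there (there (there (here refl))) ,
      K₂ₙ-≤ G (w≢tip z) (w≁tip z) (stem ∘ h) tip~ inj uniform

    -- If tips see later centres or earlier ones, an extreme fork is a hub. Otherwise centres and
    -- tips are matched, and each of the four colour patterns inside them is an obstruction.
    manyForks : ∀ {L w} (f : Fin L → Fork w) → Injective _≡_ _≡_ (centre ∘ f) → forkBound n ≤ L → Contains n
    manyForks {w = w} f inj h
      with multiRamsey (suc n)
             (edge centre centre ∷ edge tip centre ∷ edge centre tip ∷ edge tip tip ∷ []) f h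
    ... | σ , σ↑ , (t , cc) ∷ (true , tc) ∷ _ =
      hub (f (σ zero)) (f ∘ σ ∘ suc) (suc-injective ∘ Increasing⇒injective σ↑ ∘ inj)
        (λ i → tc z<s) (λ i → cc z<s)
        (offDiagonal (cc ∘ s<s) (adj-comm Γ ∘ cc ∘ s<s))
    ... | σ , σ↑ , (t , cc) ∷ (false , _) ∷ (true , ct) ∷ _ =
      hub (f (σ (fromℕ n))) (f ∘ σ ∘ inject₁) (inject₁-injective ∘ Increasing⇒injective σ↑ ∘ inj)
        (λ i → adj-comm Γ (ct (inject₁<fromℕ i))) (λ i → adj-comm Γ (cc (inject₁<fromℕ i)))
        (offDiagonal (cc ∘ inject₁-increasing) (adj-comm Γ ∘ cc ∘ inject₁-increasing))
    ... | σ , σ↑ , (t , cc) ∷ (false , tc) ∷ (false , ct) ∷ (t′ , tt) ∷ [] = obstruction t t′ centres tips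
      where
      k : Fin n → Fork w
      k = f ∘ σ ∘ inject₁
      pairing : Matched Γ (centre ∘ k) (tip ∘ k)
      pairing = matched (prong ∘ k)
        (offDiagonal (ct ∘ inject₁-increasing) (adj-comm Γ ∘ tc ∘ inject₁-increasing))
      centres : Uniform Γ t (centre ∘ k)
      centres = offDiagonal (cc ∘ inject₁-increasing) (adj-comm Γ ∘ cc ∘ inject₁-increasing)
      tips : Uniform Γ t′ (tip ∘ k)
      tips = offDiagonal (tt ∘ inject₁-increasing) (adj-comm Γ ∘ tt ∘ inject₁-increasing)
      -- `w` is adjacent to every centre and to no tip.
      centre≢tip : ∀ i j → centre (k i) ≢ tip (k j)
      centre≢tip i j = adj-≢ Γ (stem (k i)) (w≁tip (k j))
      obstruction : ∀ t t′ → Uniform Γ t (centre ∘ k) → Uniform Γ t′ (tip ∘ k) → Contains n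
      obstruction true  true  cs ts =
        _ , there (there (there (there (here refl)))) , CK-≤ G pairing cs ts centre≢tip
      obstruction true  false cs ts = _ , here refl , K*-≤ G pairing cs ts
      obstruction false true  cs ts = _ , here refl , K*-≤ G (Matched-sym Γ pairing) ts cs
      obstruction false false cs ts =
        _ , there (there (here refl)) ,
        K₁ₙ*-≤ G pairing (stem ∘ k) (w≁tip ∘ k) (w≢tip ∘ k) cs ts

    fan : ∀ w (g : Fin M → Cherry) → Injective _≡_ _≡_ (mid ∘ g) →
      (∀ i → w ~ mid (g i) ≡ true) → forkBound n ≤ M → Contains n
    fan w g inj w~ = manyForks (λ i → proj₁ (rebase (g i) (w~ i)))
      λ {i} {j} eq → inj (trans (sym (proj₂ (rebase (g i) (w~ i)))) (trans eq (proj₂ (rebase (g j) (w~ j)))))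

    -- Colours are read only for `i < j`: the three mixed pairs among `left`, `mid`, `right` are
    -- coloured in both orders, the three symmetric ones once, which makes nine.
    manyCherries : ∀ {L} (f : Fin L → Cherry) → Injective _≡_ _≡_ (mid ∘ f) → cherryBound n ≤ L → Contains n
    manyCherries f inj h
      with multiRamsey (suc (n + forkBound n))
             ( edge mid mid ∷ edge left mid ∷ edge mid left ∷ edge right mid ∷ edge mid right
             ∷ edge left left ∷ edge right right ∷ edge left right ∷ edge right left ∷ []) f h
    ... | σ , σ↑ , colours = analyse colours
      where
      g : Fin (suc (n + forkBound n)) → Cherry
      g = f ∘ σ
      last = fromℕ (n + forkBound n)
      D≤ : forkBound n ≤ n + forkBound n
      D≤ = m≤n+m (forkBound n) n
      g-inj : Injective _≡_ _≡_ (mid ∘ g)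
      g-inj = Increasing⇒injective σ↑ ∘ inj

      fan-first : ∀ (end : Cherry → Vertex G) →
        (∀ {i j} → i <ᶠ j → end (g i) ~ mid (g j) ≡ true) → Contains n
      fan-first end em = fan (end (g zero)) (g ∘ suc) (suc-injective ∘ g-inj) (λ i → em z<s) D≤

      fan-last : ∀ (end : Cherry → Vertex G) →
        (∀ {i j} → i <ᶠ j → mid (g i) ~ end (g j) ≡ true) → Contains n
      fan-last end me = fan (end (g last)) (g ∘ inject₁) (inject₁-injective ∘ g-inj)
        (λ i → adj-comm Γ (me (inject₁<fromℕ i))) D≤

      -- The pattern uses the first `n` cherries; `last` lies beyond them all and stays free to
      -- supply a centre.
      ι : Fin n → Fin (suc (n + forkBound n))
      ι i = inject₁ (i ↑ˡ forkBound n)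
      ι<last : ∀ i → ι i <ᶠ last
      ι<last i = inject₁<fromℕ (i ↑ˡ forkBound n)
      ι-≢ : ∀ {i j} → i ≢ j → ι i ≢ ι j
      ι-≢ i≢j = i≢j ∘ ↑ˡ-injective (forkBound n) _ _ ∘ inject₁-injective

      uniform : ∀ {t} (p : Cherry → Vertex G) →
        (∀ {i j} → i <ᶠ j → p (g i) ~ p (g j) ≡ t) → Uniform Γ t (p ∘ g ∘ ι)
      uniform p pp i≢j = offDiagonal pp (adj-comm Γ ∘ pp) (ι-≢ i≢j)

      pairing : ∀ (end : Cherry → Vertex G) → (∀ c → mid c ~ end c ≡ true) →
        (∀ {i j} → i <ᶠ j → end (g i) ~ mid (g j) ≡ false) →
        (∀ {i j} → i <ᶠ j → mid (g i) ~ end (g j) ≡ false) →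
        Matched Γ (mid ∘ g ∘ ι) (end ∘ g ∘ ι)
      pairing end ~end em me = matched (~end ∘ g ∘ ι) λ i≢j → offDiagonal me (adj-comm Γ ∘ em) (ι-≢ i≢j)

      -- `end′` of the last cherry is adjacent to every earlier `end` and to no earlier centre: it
      -- is the centre of K_{1,n}^*, with the ends as leaves and the cherry centres as pendants.
      spider : ∀ (end end′ : Cherry → Vertex G) → (∀ c → mid c ~ end′ c ≡ true) →
        Matched Γ (mid ∘ g ∘ ι) (end ∘ g ∘ ι) →
        (∀ {i j} → i <ᶠ j → end (g i) ~ end′ (g j) ≡ true) →
        (∀ {i j} → i <ᶠ j → mid (g i) ~ end′ (g j) ≡ false) →
        (∀ {i j} → i <ᶠ j → mid (g i) ~ mid (g j) ≡ false) →
        (∀ {i j} → i <ᶠ j → end (g i) ~ end (g j) ≡ false) → Contains n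
      spider end end′ ~end′ m ee′ me′ mm ee =
        _ , there (there (here refl)) ,
        K₁ₙ*-≤ G (Matched-sym Γ m) {w = end′ (g last)}
          (λ i → adj-comm Γ (ee′ (ι<last i)))
          (λ i → adj-comm Γ (me′ (ι<last i)))
          -- The centre of the last cherry sees its own end but no earlier centre.
          (λ i → adj-≢ Γ (~end′ (g last)) (adj-comm Γ (mm (ι<last i))))
          (uniform end ee) (uniform mid mm)

      mid~left : ∀ c → mid c ~ left c ≡ true
      mid~left c = adj-comm Γ (stem (proj₂ c))
      mid~right : ∀ c → mid c ~ right c ≡ true
      mid~right c = prong (proj₂ c)

      analyse : All (λ β → Homogeneous β g)
        ( edge mid mid ∷ edge left mid ∷ edge mid left ∷ edge right mid ∷ edge mid right
        ∷ edge left left ∷ edge right right ∷ edge left right ∷ edge right left ∷ []) → Contains n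
      analyse ((true , mm) ∷ _) = fan-first mid mm
      analyse (_ ∷ (true , lm) ∷ _) = fan-first left lm
      -- Here an end sees all earlier centres, so the common neighbour comes from the last cherry
      -- rather than the first.
      analyse (_ ∷ _ ∷ (true , ml) ∷ _) = fan-last left ml
      analyse (_ ∷ _ ∷ _ ∷ (true , rm) ∷ _) = fan-first right rm
      analyse (_ ∷ _ ∷ _ ∷ _ ∷ (true , mr) ∷ _) = fan-last right mr
      analyse ((false , mm) ∷ (false , lm) ∷ (false , ml) ∷ (false , rm) ∷ (false , mr)
        ∷ (tl , ll) ∷ (tr , rr) ∷ (tlr , lr) ∷ (trl , rl) ∷ []) = ends tl tr tlr trl ll rr lr rl
        where
        leftPairing  = pairing left mid~left lm ml
        rightPairing = pairing right mid~right rm mr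
        ends : ∀ tl tr tlr trl →
          (∀ {i j} → i <ᶠ j → left (g i) ~ left (g j) ≡ tl) →
          (∀ {i j} → i <ᶠ j → right (g i) ~ right (g j) ≡ tr) →
          (∀ {i j} → i <ᶠ j → left (g i) ~ right (g j) ≡ tlr) →
          (∀ {i j} → i <ᶠ j → right (g i) ~ left (g j) ≡ trl) → Contains n
        -- The ends form the clique and the cherry centres are its pendants.
        ends true  _     _     _     ll rr lr rl =
          _ , here refl , K*-≤ G (Matched-sym Γ leftPairing) (uniform left ll) (uniform mid mm)
        ends false true  _     _     ll rr lr rl =
          _ , here refl , K*-≤ G (Matched-sym Γ rightPairing) (uniform right rr) (uniform mid mm)
        ends false false true  _     ll rr lr rl =
          spider left right mid~right leftPairing lr mr mm ll
        ends false false false true  ll rr lr rl =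
          spider right left mid~left rightPairing rl ml mm rr
        ends false false false false ll rr lr rl =
          _ , there (here refl) ,
          nP₃-≤ G leftPairing rightPairing (uniform mid mm) (uniform left ll) (uniform right rr)
            left≁right (λ i → w≢tip (proj₂ (g (ι i))))
          where
          left≁right : ∀ i j → left (g (ι i)) ~ right (g (ι j)) ≡ false
          left≁right i j with i ≟F j
          -- No colouring compares the two ends of one cherry; their separation makes them
          -- nonadjacent.
          ... | yes refl = w≁tip (proj₂ (g (ι i)))
          ... | no  i≢j  = offDiagonal {R = λ x y → left (g x) ~ right (g y) ≡ false}
                             lr (adj-comm Γ ∘ rl) (ι-≢ i≢j)

-- Bounded counts and domination of the obstructions

corollary4p3 : ∀ {ℓ} → ExcludedMiddle ℓ → (𝓗 : Pred Graph ℓ) →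
    (∃[ C ] (∀ G → Free 𝓗 G → #disconnectedNeighbourhoods G ≤ C))
    ⇔ (∃[ n ] (0 < n × 𝓗 ≼ Obstructions n))
corollary4p3 em 𝓗 = mk⇔ necessary sufficient
  where
  necessary : ∃[ C ] (∀ G → Free 𝓗 G → #disconnectedNeighbourhoods G ≤ C) →
    ∃[ n ] (0 < n × 𝓗 ≼ Obstructions n)
  -- This exceeds `C` and is at least 2, as the cuts in cliques require.
  necessary (C , bounded) = suc (suc C) , z<s , dominated
    where
    dominated : 𝓗 ≼ Obstructions (suc (suc C))
    dominated H o with em {P = ∃ λ H₁ → 𝓗 H₁ × H₁ ≤ᵍ H}
    ... | yes found = found
    -- An `𝓗`-free obstruction would itself break the bound.
    ... | no  free  = contradiction (bounded H free) (<⇒≱ (<⇒≤ (obstruction⇒≤# C o)))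

  sufficient : ∃[ n ] (0 < n × 𝓗 ≼ Obstructions n) →
    ∃[ C ] (∀ G → Free 𝓗 G → #disconnectedNeighbourhoods G ≤ C)
  sufficient (suc m , _ , dominated) = cherryBound (suc m) , bounded
    where
    bounded : ∀ G → Free 𝓗 G → #disconnectedNeighbourhoods G ≤ cherryBound (suc m)
    bounded G free = ≮⇒≥ λ C<# →
      -- Exceeding the bound gives cherries with distinct centres, hence an obstruction in `G`, and
      -- below it a member of `𝓗`.
      let f , f-inj , sep = ≤#⇒separated-family G (<⇒≤ C<#)
          H₂ , o , H₂≤G   = manyCherries G
            (λ i → let a , b , s = sep i in a , record { separated = s }) f-inj ≤-refl
          H₁ , h , H₁≤H₂  = dominated H₂ o
      in  free (H₁ , h , ≤ᵍ-trans {H₁} {H₂} {G} H₁≤H₂ H₂≤G)
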